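{- Let $G=(V,E)$ be a graph and let $v\in V$. For each $U\subseteq N_G(v)$ define $$A_U=\begin{cases}x^{|U|} & \text{if } \bigcap_{u\in U}N_{G-v}(u)=\emptyset,\\ 0 & \text{otherwise.}\end{cases}$$ Then $$N(G,x)=N(G-v,x)+\sum_{\substack{U\subseteq N_G(v)\\ U\neq\emptyset}}(-1)^{|U|+1}x(1+x)^{|\bigcap_{u\in U}N_{G-v}(u)|}+\sum_{\substack{U\subseteq N_G(v)\\ U\neq\emptyset}}A_U.$$
   Context: All graphs are simple, finite and undirected. For a graph $G=(V,E)$ and $v\in V$, $N_G(v)=\{u\in V: \{u,v\}\in E\}$ is the open neighborhood of $v$, and $G-v$ is the subgraph of $G$ induced by $V\setminus\{v\}$. The neighborhood complex of $G$ is $\mathcal N(G)=\{A\subseteq V : \exists v\in V,\ A\subseteq N_G(v)\}$, and the neighborhood polynomial of $G$ is $N(G,x)=\sum_{A\in\mathcal N(G)}x^{|A|}$.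
   Formalization: The formal theorem assumes that G − v has at least one vertex; for the one-vertex graph the literal definition gives N(G,x) = 1 but N(G−v,x) = 0 and empty sums, so the identity fails exactly there. -}

module Defs where

open import Data.Bool.Base using (if_then_else_)
open import Data.Fin.Base using (Fin)
open import Data.Fin.Properties using (any?)
open import Data.Fin.Subset
  using (Subset; _∈_; _⊆_; _∩_; _-_; ⋂; ∣_∣; inside; outside)
open import Data.Fin.Subset.Properties using (_∈?_; _⊆?_; nonempty?)
open import Data.Integer.Base as ℤ using (ℤ; 0ℤ; 1ℤ)
open import Data.List.Base using (List; []; _∷_; _++_; map; filter; foldr; allFin)
open import Data.Nat.Base using (ℕ; zero; suc)
open import Data.Product.Base using (_×_; _,_; ∃-syntax)
open import Data.Vec.Base as Vec using (tabulate)
open import Relation.Binary.Core using (Rel)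
open import Relation.Binary.Definitions using (Symmetric; Irreflexive)
import Relation.Binary.Definitions as B
open import Relation.Binary.PropositionalEquality using (_≡_)
open import Relation.Nullary using (Dec; does; _×-dec_)
open import Relation.Unary using (Pred; Decidable)
open import Level using (0ℓ)

private
  variable
    n : ℕ

------------------------------------------------------------------------
-- Polynomials over ℤ

-- Coefficient lists, constant term first. Trailing zeros are allowed, so
-- equality of polynomials is _≈_ rather than _≡_.
Poly : Set
Poly = List ℤ

coeff : Poly → ℕ → ℤ
coeff []      _       = 0ℤ
coeff (a ∷ p) zero    = a
coeff (a ∷ p) (suc k) = coeff p k

infix 4 _≈_

_≈_ : Rel Poly 0ℓ
p ≈ q = ∀ k → coeff p k ≡ coeff q k

infixl 6 _+_
infixl 7 _*_
infixr 8 _^_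

const : ℤ → Poly
const a = a ∷ []

𝟘 𝟙 x : Poly
𝟘 = []
𝟙 = const 1ℤ
x = 0ℤ ∷ 1ℤ ∷ []

_+_ : Poly → Poly → Poly
[]      + q       = q
(a ∷ p) + []      = a ∷ p
(a ∷ p) + (b ∷ q) = (a ℤ.+ b) ∷ (p + q)

_*_ : Poly → Poly → Poly
[]      * q = []
(a ∷ p) * q = map (a ℤ.*_) q + (0ℤ ∷ (p * q))

_^_ : Poly → ℕ → Poly
p ^ zero  = 𝟙
p ^ suc k = p * (p ^ k)

------------------------------------------------------------------------
-- Sums over the subsets satisfying a decidable predicate

subsets : ∀ n → List (Subset n)
subsets zero    = Vec.[] ∷ []
subsets (suc n) = map (outside Vec.∷_) (subsets n) ++ map (inside Vec.∷_) (subsets n)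

∑ : {P : Pred (Subset n) 0ℓ} → Decidable P → (Subset n → Poly) → Poly
∑ {n} P? f = foldr _+_ 𝟘 (map f (filter P? (subsets n)))

------------------------------------------------------------------------
-- Graphs

-- The vertex set is a subset of Fin n, so that G and its induced subgraphs
-- draw their vertices from the same type. It may be empty.
record Graph (n : ℕ) : Set₁ where
  field
    V        : Subset n
    _~_      : Rel (Fin n) 0ℓ
    _~?_     : B.Decidable _~_
    ~-sym    : Symmetric _~_
    ~-irrefl : Irreflexive _≡_ _~_
    ~⇒∈V     : ∀ {u w} → u ~ w → u ∈ V

open Graph public using (V)

neighbourhood : Graph n → Fin n → Subset n
neighbourhood G v = tabulate (λ u → does (v ~? u))
  where open Graph G

-- The subgraph induced by V ∖ {v}.
delete : Graph n → Fin n → Graph n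
delete G v = record
  { V        = V′
  ; _~_      = λ u w → u ∈ V′ × w ∈ V′ × u ~ w
  ; _~?_     = λ u w → u ∈? V′ ×-dec w ∈? V′ ×-dec u ~? w
  ; ~-sym    = λ (u∈ , w∈ , u~w) → w∈ , u∈ , ~-sym u~w
  ; ~-irrefl = λ u≡w (_ , _ , u~w) → ~-irrefl u≡w u~w
  ; ~⇒∈V     = λ (u∈ , _) → u∈
  }
  where
  open Graph G hiding (V)
  V′ = V G - v

-- Intersection of the neighbourhoods of the elements of U, taken inside V G
-- (which matters only for U = ∅).
commonNeighbours : Graph n → Subset n → Subset n
commonNeighbours {n} G U =
  V G ∩ ⋂ (map (neighbourhood G) (filter (_∈? U) (allFin n)))

------------------------------------------------------------------------
-- The neighbourhood complex and the neighbourhood polynomial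

-- If V G is empty then so is the complex: not even ∅ is a face.
_∈𝒩_ : Subset n → Graph n → Set
A ∈𝒩 G = A ⊆ V G × ∃[ v ] (v ∈ V G × A ⊆ neighbourhood G v)

_∈𝒩?_ : (A : Subset n) (G : Graph n) → Dec (A ∈𝒩 G)
A ∈𝒩? G = A ⊆? V G ×-dec any? (λ v → v ∈? V G ×-dec A ⊆? neighbourhood G v)

N : Graph n → Poly
N G = ∑ (_∈𝒩? G) (λ A → x ^ ∣ A ∣)

-- The A_U of a vertex v of G, as a function of the set U.
term : Graph n → Fin n → Subset n → Poly
term G v U =
  if does (nonempty? (commonNeighbours (delete G v) U)) then 𝟘 else x ^ ∣ U ∣

{-# OPTIONS --safe #-}

-- Sort the faces A of G by whether they contain v.
--
-- A set A with v ∉ A is a face of G iff it is a face of G - v or a subset of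
-- N(v); it is not a face of G - v exactly when its elements have no common
-- neighbour there. These faces give N(G - v) and the sum of the A_U; the set ∅
-- is counted only in N(G - v), of which it is a face because V(G - v) ≠ ∅.
--
-- A set B ∪ {v} with v ∉ B is a face of G iff the set
-- W_B = {w ∈ N(v) : B ⊆ N_{G-v}(w)} is nonempty. The sum of (-1)^{|U|+1} over
-- the nonempty U ⊆ W_B is 1 if W_B ≠ ∅ and 0 otherwise, and U ⊆ W_B says that
-- B lies in the common neighbourhood C of U in G - v. Exchanging the sums over
-- B and U leaves the sum of x^{|B|+1} over B ⊆ C, that is x(1+x)^{|C|}.

module Submission where

open import Defs
open import Data.Bool.Base using (if_then_else_)
open import Data.Fin.Base using (Fin; zero; suc)
open import Data.Fin.Properties using (_≟_)
open import Data.Fin.Subset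
  using (Subset; _∈_; _∉_; _⊆_; _-_; ⋂; ⊥; ∣_∣; Nonempty; inside; outside)
open import Data.Fin.Subset.Properties
  using ( _∈?_; _⊆?_; nonempty?; ∈⊤; ∉⊥; drop-there; x∈p∩q⁺; x∈p∩q⁻
        ; p─q⊆p; x∈p∧x≢y⇒x∈p-y )
open import Data.Integer.Base as ℤ using (ℤ; -1ℤ; 0ℤ; 1ℤ)
import Data.Integer.Properties as ℤ
open import Data.Integer.Tactic.RingSolver using (solve-∀)
open import Data.List.Base using (List; []; _∷_; _++_; map; filter; foldr; allFin)
open import Data.List.Membership.Propositional.Properties
  using (∈-filter⁺; ∈-filter⁻; ∈-allFin)
open import Data.List.Relation.Unary.All as All using (All; []; _∷_)
import Data.List.Relation.Unary.All.Properties as All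
open import Data.Nat.Base as ℕ using (ℕ; zero; suc)
open import Data.Product.Base using (_×_; _,_; proj₁; proj₂)
open import Data.Sum.Base using (_⊎_; inj₁; inj₂)
open import Data.Vec.Base as Vec using (_[_]≔_; here; there; tabulate)
open import Data.Vec.Properties
  using (lookup∘tabulate; []=⇒lookup; lookup⇒[]=; []≔-updates; []≔-minimal)
open import Function.Base using (_∘_)
open import Level using (Level; 0ℓ)
open import Relation.Binary.PropositionalEquality
open import Relation.Nullary
  using (Dec; yes; no; does; ¬_; ¬?; _×-dec_; contradiction)
open import Relation.Nullary.Decidable using (dec-true)
open import Relation.Unary using (Pred; Decidable)

open ≡-Reasoning

private
  variable
    n : ℕ
    p q r : Level
    P : Set p
    Q : Set q
    R : Set r

-- Iverson brackets of decidable propositions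

⟦_⟧ : Dec P → ℤ
⟦ P? ⟧ = if does P? then 1ℤ else 0ℤ

⟦⟧-cong : (P? : Dec P) (Q? : Dec Q) → (P → Q) → (Q → P) → ⟦ P? ⟧ ≡ ⟦ Q? ⟧
⟦⟧-cong (yes _) (yes _) f g = refl
⟦⟧-cong (yes p) (no ¬q) f g = contradiction (f p) ¬q
⟦⟧-cong (no ¬p) (yes q) f g = contradiction (g q) ¬p
⟦⟧-cong (no _)  (no _)  f g = refl

⟦⟧-yes : (P? : Dec P) → P → ⟦ P? ⟧ ≡ 1ℤ
⟦⟧-yes (yes _) p = refl
⟦⟧-yes (no ¬p) p = contradiction p ¬p

⟦⟧-× : (P? : Dec P) (Q? : Dec Q) → ⟦ P? ×-dec Q? ⟧ ≡ ⟦ P? ⟧ ℤ.* ⟦ Q? ⟧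
⟦⟧-× (yes _) (yes _) = refl
⟦⟧-× (yes _) (no _)  = refl
⟦⟧-× (no _)  _       = refl

⟦⟧-⊎ : (P? : Dec P) (Q? : Dec Q) (R? : Dec R) →
       (P → Q ⊎ R) → (Q → P) → (R → P) → (Q → ¬ R) →
       ⟦ P? ⟧ ≡ ⟦ Q? ⟧ ℤ.+ ⟦ R? ⟧
⟦⟧-⊎ (yes p) (yes q) (yes r) f g h d = contradiction r (d q)
⟦⟧-⊎ (yes p) (yes q) (no ¬r) f g h d = refl
⟦⟧-⊎ (yes p) (no ¬q) (yes r) f g h d = refl
⟦⟧-⊎ (yes p) (no ¬q) (no ¬r) f g h d with f p
... | inj₁ q = contradiction q ¬q
... | inj₂ r = contradiction r ¬r
⟦⟧-⊎ (no ¬p) (yes q) _       f g h d = contradiction (g q) ¬p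
⟦⟧-⊎ (no ¬p) (no ¬q) (yes r) f g h d = contradiction (h r) ¬p
⟦⟧-⊎ (no ¬p) (no ¬q) (no ¬r) f g h d = refl

-- Integer sums over all subsets

-- The recursion mirrors that of `subsets` and of `⊆?`, so that inductions on `n` unfold a sum and
-- its brackets by computation.
sum : (Subset n → ℤ) → ℤ
sum {zero}  f = f Vec.[]
sum {suc n} f = sum (f ∘ (outside Vec.∷_)) ℤ.+ sum (f ∘ (inside Vec.∷_))

sum-cong : {f g : Subset n → ℤ} → (∀ A → f A ≡ g A) → sum f ≡ sum g
sum-cong {zero}  f≗g = f≗g _
sum-cong {suc n} f≗g =
  cong₂ ℤ._+_ (sum-cong (f≗g ∘ (outside Vec.∷_))) (sum-cong (f≗g ∘ (inside Vec.∷_)))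

interchange : ∀ a b c d → (a ℤ.+ b) ℤ.+ (c ℤ.+ d) ≡ (a ℤ.+ c) ℤ.+ (b ℤ.+ d)
interchange = solve-∀

sum-+ : (f g : Subset n → ℤ) → sum (λ A → f A ℤ.+ g A) ≡ sum f ℤ.+ sum g
sum-+ {zero}  f g = refl
sum-+ {suc n} f g =
  trans (cong₂ ℤ._+_ (sum-+ (f ∘ (outside Vec.∷_)) _) (sum-+ (f ∘ (inside Vec.∷_)) _))
        (interchange (sum (f ∘ (outside Vec.∷_))) (sum (g ∘ (outside Vec.∷_)))
                     (sum (f ∘ (inside Vec.∷_))) (sum (g ∘ (inside Vec.∷_))))

sum-* : ∀ c (f : Subset n → ℤ) → sum (λ A → c ℤ.* f A) ≡ c ℤ.* sum f
sum-* {zero}  c f = refl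
sum-* {suc n} c f =
  trans (cong₂ ℤ._+_ (sum-* c (f ∘ (outside Vec.∷_))) (sum-* c (f ∘ (inside Vec.∷_))))
        (sym (ℤ.*-distribˡ-+ c _ _))

sum-zero : {f : Subset n → ℤ} → (∀ A → f A ≡ 0ℤ) → sum f ≡ 0ℤ
sum-zero {zero}  f≗0 = f≗0 _
sum-zero {suc n} f≗0 =
  cong₂ ℤ._+_ (sum-zero (f≗0 ∘ (outside Vec.∷_))) (sum-zero (f≗0 ∘ (inside Vec.∷_)))

sum-swap : ∀ {m} (f : Subset m → Subset n → ℤ) →
           sum (λ A → sum (λ B → f A B)) ≡ sum (λ B → sum (λ A → f A B))
sum-swap {m = zero}  f = refl
sum-swap {m = suc m} f =
  trans (cong₂ ℤ._+_ (sum-swap (f ∘ (outside Vec.∷_))) (sum-swap (f ∘ (inside Vec.∷_))))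
        (sym (sum-+ (λ B → sum (λ A → f (outside Vec.∷ A) B))
                    (λ B → sum (λ A → f (inside Vec.∷ A) B))))

-- Inserting `v` is a bijection from the sets avoiding `v` onto those containing it. Both sums still
-- range over all subsets and use a bracket as weight, so that a face containing `v` is indexed by
-- the rest of its elements.
sum-split : (v : Fin n) (f : Subset n → ℤ) →
            sum f ≡ sum (λ A → ⟦ ¬? (v ∈? A) ⟧ ℤ.* f A)
                ℤ.+ sum (λ A → ⟦ ¬? (v ∈? A) ⟧ ℤ.* f (A [ v ]≔ inside))
-- The weight computes to 1 on sets without the first element and to 0 on the others. On the former,
-- insertion only turns the head into `inside`.
sum-split {suc n} zero f = sym (cong₂ ℤ._+_ (half outside) (half inside))
  where
  half : ∀ s → sum {n} (λ A → 1ℤ ℤ.* f (s Vec.∷ A)) ℤ.+ sum {n} (λ A → 0ℤ)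
             ≡ sum (λ A → f (s Vec.∷ A))
  half s = trans (cong₂ ℤ._+_ (sum-cong {n} (λ A → ℤ.*-identityˡ _)) (sum-zero {n} (λ A → refl)))
                 (ℤ.+-identityʳ _)
sum-split {suc n} (suc v) f =
  trans (cong₂ ℤ._+_ (sum-split v (f ∘ (outside Vec.∷_))) (sum-split v (f ∘ (inside Vec.∷_))))
        (interchange (without outside) (withv outside) (without inside) (withv inside))
  where
  without withv : _ → ℤ
  without s = sum (λ A → ⟦ ¬? (v ∈? A) ⟧ ℤ.* f (s Vec.∷ A))
  withv   s = sum (λ A → ⟦ ¬? (v ∈? A) ⟧ ℤ.* f (s Vec.∷ (A [ v ]≔ inside)))

-- Inserting an element into a subset

∣insert∣ : (v : Fin n) (A : Subset n) → v ∉ A → ∣ A [ v ]≔ inside ∣ ≡ suc ∣ A ∣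
∣insert∣ zero    (outside Vec.∷ A) v∉A = refl
∣insert∣ zero    (inside Vec.∷ A)  v∉A = contradiction here v∉A
∣insert∣ (suc v) (outside Vec.∷ A) v∉A = ∣insert∣ v A (v∉A ∘ there)
∣insert∣ (suc v) (inside Vec.∷ A)  v∉A = cong suc (∣insert∣ v A (v∉A ∘ there))

∈-insert⁻ : (v : Fin n) (A : Subset n) {u : Fin n} → u ∈ A [ v ]≔ inside → u ≡ v ⊎ u ∈ A
∈-insert⁻ zero    (_ Vec.∷ A) here       = inj₁ refl
∈-insert⁻ zero    (_ Vec.∷ A) (there u∈) = inj₂ (there u∈)
∈-insert⁻ (suc v) (_ Vec.∷ A) here       = inj₂ here
∈-insert⁻ (suc v) (_ Vec.∷ A) (there u∈) with ∈-insert⁻ v A u∈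
... | inj₁ u≡v = inj₁ (cong suc u≡v)
... | inj₂ u∈A = inj₂ (there u∈A)

⊆-insert : (v : Fin n) (A : Subset n) → A ⊆ A [ v ]≔ inside
⊆-insert v A {u} u∈A with u ≟ v
... | yes refl = []≔-updates A v
... | no u≢v   = []≔-minimal A u v u≢v u∈A

-- Inclusion-exclusion

sign : Subset n → ℤ
sign U = -1ℤ ℤ.^ (∣ U ∣ ℕ.+ 1)

⊆-sign : (W : Subset n) →
         sum (λ U → ⟦ U ⊆? W ⟧ ℤ.* sign U) ≡ ℤ.- ⟦ ¬? (nonempty? W) ⟧
⊆-sign Vec.[] = refl
⊆-sign {suc n} (outside Vec.∷ W) = begin
  -- A set containing the first element is not included in `outside Vec.∷ W`, so the second half of
  -- the sum computes to zeros.
  sum (λ U → ⟦ U ⊆? W ⟧ ℤ.* sign U) ℤ.+ sum {n} (λ U → 0ℤ)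
    ≡⟨ cong₂ ℤ._+_ (⊆-sign W) (sum-zero {n} (λ U → refl)) ⟩
  ℤ.- ⟦ ¬? (nonempty? W) ⟧ ℤ.+ 0ℤ
    ≡⟨ ℤ.+-identityʳ _ ⟩
  ℤ.- ⟦ ¬? (nonempty? W) ⟧
    ≡⟨ cong ℤ.-_ (⟦⟧-cong (¬? (nonempty? W)) (¬? (nonempty? (outside Vec.∷ W)))
         (λ { ∅W (suc u , u∈) → ∅W (u , drop-there u∈) })
         (λ { ∅W (u , u∈) → ∅W (suc u , there u∈) })) ⟩
  ℤ.- ⟦ ¬? (nonempty? (outside Vec.∷ W)) ⟧ ∎
⊆-sign (inside Vec.∷ W) = begin
  sum (λ U → ⟦ U ⊆? W ⟧ ℤ.* sign U) ℤ.+ sum (λ U → ⟦ U ⊆? W ⟧ ℤ.* (-1ℤ ℤ.* sign U))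
    ≡⟨ sum-+ (λ U → ⟦ U ⊆? W ⟧ ℤ.* sign U) (λ U → ⟦ U ⊆? W ⟧ ℤ.* (-1ℤ ℤ.* sign U)) ⟨
  sum (λ U → ⟦ U ⊆? W ⟧ ℤ.* sign U ℤ.+ ⟦ U ⊆? W ⟧ ℤ.* (-1ℤ ℤ.* sign U))
    ≡⟨ sum-zero (λ U → cancel ⟦ U ⊆? W ⟧ (sign U)) ⟩
  0ℤ ∎
  where
  cancel : ∀ a b → a ℤ.* b ℤ.+ a ℤ.* (-1ℤ ℤ.* b) ≡ 0ℤ
  cancel = solve-∀

⟦⟧-¬ : (P? : Dec P) → 1ℤ ℤ.- ⟦ ¬? P? ⟧ ≡ ⟦ P? ⟧
⟦⟧-¬ (yes _) = refl
⟦⟧-¬ (no _)  = refl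

-- U is empty iff U ⊆ ⊥, so the correction for U = ∅ is itself an instance of
-- ⊆-sign.
inclusion-exclusion : (W : Subset n) →
  sum (λ U → ⟦ U ⊆? W ×-dec nonempty? U ⟧ ℤ.* sign U) ≡ ⟦ nonempty? W ⟧
inclusion-exclusion {n} W = begin
  s₁                                                ≡⟨ add-subtract s₁ s₀ ⟩
  (s₁ ℤ.+ s₀) ℤ.- s₀                                ≡⟨ cong₂ ℤ._-_ split (⊆-sign {n} ⊥) ⟩
  ℤ.- ⟦ ¬? (nonempty? W) ⟧ ℤ.- ℤ.- ⟦ ¬? (nonempty? {n} ⊥) ⟧
    ≡⟨ cong (λ i → ℤ.- ⟦ ¬? (nonempty? W) ⟧ ℤ.- ℤ.- i)
         (⟦⟧-yes (¬? (nonempty? {n} ⊥)) (λ (_ , u∈⊥) → ∉⊥ u∈⊥)) ⟩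
  ℤ.- ⟦ ¬? (nonempty? W) ⟧ ℤ.+ 1ℤ                   ≡⟨ ℤ.+-comm (ℤ.- ⟦ ¬? (nonempty? W) ⟧) 1ℤ ⟩
  1ℤ ℤ.- ⟦ ¬? (nonempty? W) ⟧                       ≡⟨ ⟦⟧-¬ (nonempty? W) ⟩
  ⟦ nonempty? W ⟧                                   ∎
  where
  s₁ = sum (λ U → ⟦ U ⊆? W ×-dec nonempty? U ⟧ ℤ.* sign U)
  s₀ = sum {n} (λ U → ⟦ U ⊆? ⊥ ⟧ ℤ.* sign U)

  add-subtract : ∀ a b → a ≡ (a ℤ.+ b) ℤ.- b
  add-subtract = solve-∀

  partition : ∀ U → ⟦ U ⊆? W ⟧ ≡ ⟦ U ⊆? W ×-dec nonempty? U ⟧ ℤ.+ ⟦ U ⊆? ⊥ ⟧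
  partition U = ⟦⟧-⊎ (U ⊆? W) (U ⊆? W ×-dec nonempty? U) (U ⊆? ⊥)
    (λ U⊆W → case-nonempty U⊆W (nonempty? U))
    proj₁
    (λ U⊆⊥ u∈U → contradiction (U⊆⊥ u∈U) ∉⊥)
    (λ (_ , _ , u∈U) U⊆⊥ → ∉⊥ (U⊆⊥ u∈U))
    where
    case-nonempty : U ⊆ W → Dec (Nonempty U) → (U ⊆ W × Nonempty U) ⊎ U ⊆ ⊥
    case-nonempty U⊆W (yes U≠∅) = inj₁ (U⊆W , U≠∅)
    case-nonempty U⊆W (no U=∅)  = inj₂ (λ u∈U → contradiction (_ , u∈U) U=∅)

  split : s₁ ℤ.+ s₀ ≡ ℤ.- ⟦ ¬? (nonempty? W) ⟧
  split = begin
    s₁ ℤ.+ s₀ ≡⟨ sum-+ (λ U → ⟦ U ⊆? W ×-dec nonempty? U ⟧ ℤ.* sign U) (λ U → ⟦ U ⊆? ⊥ ⟧ ℤ.* sign U) ⟨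
    sum (λ U → ⟦ U ⊆? W ×-dec nonempty? U ⟧ ℤ.* sign U ℤ.+ ⟦ U ⊆? ⊥ ⟧ ℤ.* sign U)
      ≡⟨ sum-cong (λ U → trans (cong (ℤ._* sign U) (partition U))
           (ℤ.*-distribʳ-+ (sign U) ⟦ U ⊆? W ×-dec nonempty? U ⟧ ⟦ U ⊆? ⊥ ⟧)) ⟨
    sum (λ U → ⟦ U ⊆? W ⟧ ℤ.* sign U) ≡⟨ ⊆-sign W ⟩
    ℤ.- ⟦ ¬? (nonempty? W) ⟧ ∎

-- Coefficients

coeff-+ : ∀ f g k → coeff (f + g) k ≡ coeff f k ℤ.+ coeff g k
coeff-+ []      g       k       = sym (ℤ.+-identityˡ _)
coeff-+ (a ∷ f) []      k       = sym (ℤ.+-identityʳ _)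
coeff-+ (a ∷ f) (b ∷ g) zero    = refl
coeff-+ (a ∷ f) (b ∷ g) (suc k) = coeff-+ f g k

coeff-scale : ∀ c f k → coeff (map (c ℤ.*_) f) k ≡ c ℤ.* coeff f k
coeff-scale c []      k       = sym (ℤ.*-zeroʳ c)
coeff-scale c (a ∷ f) zero    = refl
coeff-scale c (a ∷ f) (suc k) = coeff-scale c f k

-- Multiplication by `x`, on coefficient sequences.
shift : (ℕ → ℤ) → ℕ → ℤ
shift f zero    = 0ℤ
shift f (suc k) = f k

coeff-const-* : ∀ a g k → coeff (const a * g) k ≡ a ℤ.* coeff g k
coeff-const-* a g k = begin
  coeff (map (a ℤ.*_) g + (0ℤ ∷ [])) k
    ≡⟨ coeff-+ (map (a ℤ.*_) g) _ k ⟩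
  coeff (map (a ℤ.*_) g) k ℤ.+ coeff (0ℤ ∷ []) k
    ≡⟨ cong₂ ℤ._+_ (coeff-scale a g k) (coeff-0 k) ⟩
  a ℤ.* coeff g k ℤ.+ 0ℤ
    ≡⟨ ℤ.+-identityʳ _ ⟩
  a ℤ.* coeff g k ∎
  where
  coeff-0 : ∀ k → coeff (0ℤ ∷ []) k ≡ 0ℤ
  coeff-0 zero    = refl
  coeff-0 (suc k) = refl

-- Read from the left, each product in the formula has a first factor with at most two coefficients,
-- so this rule stands in for the general convolution.
coeff-linear-* : ∀ a b g k →
  coeff ((a ∷ b ∷ []) * g) k ≡ a ℤ.* coeff g k ℤ.+ b ℤ.* shift (coeff g) k
coeff-linear-* a b g k = begin
  coeff (map (a ℤ.*_) g + (0ℤ ∷ const b * g)) k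
    ≡⟨ coeff-+ (map (a ℤ.*_) g) _ k ⟩
  coeff (map (a ℤ.*_) g) k ℤ.+ coeff (0ℤ ∷ const b * g) k
    ≡⟨ cong₂ ℤ._+_ (coeff-scale a g k) (tail k) ⟩
  a ℤ.* coeff g k ℤ.+ b ℤ.* shift (coeff g) k ∎
  where
  tail : ∀ k → coeff (0ℤ ∷ const b * g) k ≡ b ℤ.* shift (coeff g) k
  tail zero    = sym (ℤ.*-zeroʳ b)
  tail (suc k) = coeff-const-* b g k

coeff-x^suc : ∀ m k → coeff (x ^ suc m) k ≡ shift (coeff (x ^ m)) k
coeff-x^suc m k = trans (coeff-linear-* 0ℤ 1ℤ (x ^ m) k) (simplify (coeff (x ^ m) k) _)
  where
  simplify : ∀ a b → 0ℤ ℤ.* a ℤ.+ 1ℤ ℤ.* b ≡ b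
  simplify = solve-∀

coeff-const-*-x-* : ∀ c g k → coeff (const c * x * g) k ≡ c ℤ.* shift (coeff g) k
-- The product `const c * x` computes to a list with these two unsimplified entries.
coeff-const-*-x-* c g k = trans (coeff-linear-* (c ℤ.* 0ℤ ℤ.+ 0ℤ) (c ℤ.* 1ℤ) g k)
                                (simplify c (coeff g k) _)
  where
  simplify : ∀ c a b → (c ℤ.* 0ℤ ℤ.+ 0ℤ) ℤ.* a ℤ.+ (c ℤ.* 1ℤ) ℤ.* b ≡ c ℤ.* b
  simplify = solve-∀

shift-cong : ∀ {f g} → (∀ k → f k ≡ g k) → ∀ k → shift f k ≡ shift g k
shift-cong f≗g zero    = refl
shift-cong f≗g (suc k) = f≗g k

shift-sum : (f : Subset n → ℕ → ℤ) → ∀ k →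
            shift (λ k → sum (λ A → f A k)) k ≡ sum (λ A → shift (f A) k)
shift-sum {n} f zero = sym (sum-zero {n} (λ A → refl))
shift-sum f (suc k)  = refl

shift-* : ∀ c f k → shift (λ k → c ℤ.* f k) k ≡ c ℤ.* shift f k
shift-* c f zero    = sym (ℤ.*-zeroʳ c)
shift-* c f (suc k) = refl

-- The binomial theorem in subset form: expanding the product means choosing `𝟙` or `x` for each
-- element of `C`, and `B` collects the elements for which `x` was chosen.
coeff-[1+x]^ : (C : Subset n) → ∀ k →
  coeff ((𝟙 + x) ^ ∣ C ∣) k ≡ sum (λ B → ⟦ B ⊆? C ⟧ ℤ.* coeff (x ^ ∣ B ∣) k)
-- The same expansion times `x`. It serves the choice of `x` at a new element of `C`, and later the
-- factor `x` of the formula, which accounts for `v` itself.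
shift-coeff-[1+x]^ : (C : Subset n) → ∀ k →
  shift (coeff ((𝟙 + x) ^ ∣ C ∣)) k
  ≡ sum (λ B → ⟦ B ⊆? C ⟧ ℤ.* coeff (x ^ suc ∣ B ∣) k)

coeff-[1+x]^ Vec.[] k = sym (ℤ.*-identityˡ _)
coeff-[1+x]^ {suc n} (outside Vec.∷ C) k = begin
  coeff ((𝟙 + x) ^ ∣ C ∣) k
    ≡⟨ ℤ.+-identityʳ _ ⟨
  coeff ((𝟙 + x) ^ ∣ C ∣) k ℤ.+ 0ℤ
    ≡⟨ cong₂ ℤ._+_ (coeff-[1+x]^ C k) (sym (sum-zero {n} (λ B → refl))) ⟩
  sum (λ B → ⟦ B ⊆? C ⟧ ℤ.* coeff (x ^ ∣ B ∣) k) ℤ.+ sum {n} (λ B → 0ℤ) ∎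
coeff-[1+x]^ (inside Vec.∷ C) k = begin
  coeff ((𝟙 + x) * (𝟙 + x) ^ ∣ C ∣) k
    -- Here `𝟙 + x` has computed to `1ℤ ∷ 1ℤ ∷ []`.
    ≡⟨ coeff-linear-* 1ℤ 1ℤ ((𝟙 + x) ^ ∣ C ∣) k ⟩
  1ℤ ℤ.* coeff ((𝟙 + x) ^ ∣ C ∣) k ℤ.+ 1ℤ ℤ.* shift (coeff ((𝟙 + x) ^ ∣ C ∣)) k
    ≡⟨ cong₂ ℤ._+_ (ℤ.*-identityˡ (coeff ((𝟙 + x) ^ ∣ C ∣) k)) (ℤ.*-identityˡ _) ⟩
  coeff ((𝟙 + x) ^ ∣ C ∣) k ℤ.+ shift (coeff ((𝟙 + x) ^ ∣ C ∣)) k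
    ≡⟨ cong₂ ℤ._+_ (coeff-[1+x]^ C k) (shift-coeff-[1+x]^ C k) ⟩
  sum (λ B → ⟦ B ⊆? C ⟧ ℤ.* coeff (x ^ ∣ B ∣) k)
    ℤ.+ sum (λ B → ⟦ B ⊆? C ⟧ ℤ.* coeff (x ^ suc ∣ B ∣) k) ∎

shift-coeff-[1+x]^ C k = begin
  shift (coeff ((𝟙 + x) ^ ∣ C ∣)) k
    ≡⟨ shift-cong (coeff-[1+x]^ C) k ⟩
  shift (λ k → sum (λ B → ⟦ B ⊆? C ⟧ ℤ.* coeff (x ^ ∣ B ∣) k)) k
    ≡⟨ shift-sum (λ B k → ⟦ B ⊆? C ⟧ ℤ.* coeff (x ^ ∣ B ∣) k) k ⟩
  sum (λ B → shift (λ k → ⟦ B ⊆? C ⟧ ℤ.* coeff (x ^ ∣ B ∣) k) k)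
    ≡⟨ sum-cong (λ B → trans (shift-* ⟦ B ⊆? C ⟧ (coeff (x ^ ∣ B ∣)) k)
                             (cong (⟦ B ⊆? C ⟧ ℤ.*_) (sym (coeff-x^suc ∣ B ∣ k)))) ⟩
  sum (λ B → ⟦ B ⊆? C ⟧ ℤ.* coeff (x ^ suc ∣ B ∣) k) ∎

-- From sums over lists to sums over subsets

listSum : ∀ {a} {A : Set a} → (A → ℤ) → List A → ℤ
listSum f = foldr (λ a s → f a ℤ.+ s) 0ℤ

listSum-++ : ∀ {a} {A : Set a} (f : A → ℤ) xs ys →
             listSum f (xs ++ ys) ≡ listSum f xs ℤ.+ listSum f ys
listSum-++ f []       ys = sym (ℤ.+-identityˡ _)
listSum-++ f (y ∷ xs) ys =
  trans (cong (λ s → f y ℤ.+ s) (listSum-++ f xs ys)) (sym (ℤ.+-assoc (f y) _ _))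

listSum-map : ∀ {a b} {A : Set a} {B : Set b} (f : B → ℤ) (g : A → B) xs →
              listSum f (map g xs) ≡ listSum (f ∘ g) xs
listSum-map f g []       = refl
listSum-map f g (y ∷ xs) = cong (λ s → f (g y) ℤ.+ s) (listSum-map f g xs)

listSum-subsets : (f : Subset n → ℤ) → listSum f (subsets n) ≡ sum f
listSum-subsets {zero}  f = ℤ.+-identityʳ _
listSum-subsets {suc n} f = begin
  listSum f (map (outside Vec.∷_) (subsets n) ++ map (inside Vec.∷_) (subsets n))
    ≡⟨ listSum-++ f (map (outside Vec.∷_) (subsets n)) _ ⟩
  listSum f (map (outside Vec.∷_) (subsets n)) ℤ.+ listSum f (map (inside Vec.∷_) (subsets n))
    ≡⟨ cong₂ ℤ._+_ (half outside) (half inside) ⟩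
  sum f ∎
  where
  half : ∀ s → listSum f (map (s Vec.∷_) (subsets n)) ≡ sum (f ∘ (s Vec.∷_))
  half s = trans (listSum-map f (s Vec.∷_) (subsets n)) (listSum-subsets (f ∘ (s Vec.∷_)))

-- Trades the filter for a bracket weight. All sums then have the same index set, so they can be
-- added termwise and exchanged.
coeff-∑ : {P : Pred (Subset n) 0ℓ} (P? : Decidable P) (f : Subset n → Poly) → ∀ k →
          coeff (∑ P? f) k ≡ sum (λ A → ⟦ P? A ⟧ ℤ.* coeff (f A) k)
coeff-∑ {n} P? f k = trans (go (subsets n)) (listSum-subsets (λ A → ⟦ P? A ⟧ ℤ.* coeff (f A) k))
  where
  go : ∀ As → coeff (foldr _+_ 𝟘 (map f (filter P? As))) k
            ≡ listSum (λ A → ⟦ P? A ⟧ ℤ.* coeff (f A) k) As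
  go [] = refl
  go (A ∷ As) with P? A
  ... | yes _ = trans (coeff-+ (f A) _ k)
                      (cong₂ ℤ._+_ (sym (ℤ.*-identityˡ (coeff (f A) k))) (go As))
  ... | no _  = trans (go As) (sym (ℤ.+-identityˡ _))

-- Neighbourhoods

module _ {P : Pred (Fin n) 0ℓ} (P? : Decidable P) {u : Fin n} where

  ∈-tabulate⁺ : P u → u ∈ tabulate (does ∘ P?)
  ∈-tabulate⁺ pu = lookup⇒[]= u _ (trans (lookup∘tabulate (does ∘ P?) u) (dec-true (P? u) pu))

  ∈-tabulate⁻ : u ∈ tabulate (does ∘ P?) → P u
  -- If `P? u` is `no`, the second equation becomes `false ≡ true`, which leaves only the `yes`
  -- case.
  ∈-tabulate⁻ u∈ with P? u | trans (sym (lookup∘tabulate (does ∘ P?) u)) ([]=⇒lookup u∈)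
  ... | yes pu | _ = pu

module _ (G : Graph n) where
  open Graph G hiding (V)

  ∈-neighbourhood⁺ : ∀ {u w} → u ~ w → w ∈ neighbourhood G u
  ∈-neighbourhood⁺ {u} = ∈-tabulate⁺ (u ~?_)

  ∈-neighbourhood⁻ : ∀ {u w} → w ∈ neighbourhood G u → u ~ w
  ∈-neighbourhood⁻ {u} = ∈-tabulate⁻ (u ~?_)

  neighbourhood⊆V : ∀ {u} → neighbourhood G u ⊆ V G
  neighbourhood⊆V w∈ = ~⇒∈V (~-sym (∈-neighbourhood⁻ w∈))

  neighbourhood-sym : ∀ {u w} → w ∈ neighbourhood G u → u ∈ neighbourhood G w
  neighbourhood-sym w∈ = ∈-neighbourhood⁺ (~-sym (∈-neighbourhood⁻ w∈))

∈-⋂⁺ : ∀ {u : Fin n} {ps} → All (u ∈_) ps → u ∈ ⋂ ps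
∈-⋂⁺ []         = ∈⊤
∈-⋂⁺ (u∈ ∷ u∈s) = x∈p∩q⁺ (u∈ , ∈-⋂⁺ u∈s)

∈-⋂⁻ : ∀ {u : Fin n} ps → u ∈ ⋂ ps → All (u ∈_) ps
∈-⋂⁻ []       u∈ = []
∈-⋂⁻ (p ∷ ps) u∈ = let u∈p , u∈⋂ = x∈p∩q⁻ p (⋂ ps) u∈ in u∈p ∷ ∈-⋂⁻ ps u∈⋂

module _ (G : Graph n) {U : Subset n} {w : Fin n} where

  ∈-commonNeighbours⁺ : w ∈ V G → (∀ {u} → u ∈ U → w ∈ neighbourhood G u) →
                        w ∈ commonNeighbours G U
  ∈-commonNeighbours⁺ w∈V w∈N = x∈p∩q⁺ (w∈V , ∈-⋂⁺ (All.map⁺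
    (All.tabulate (λ u∈ → w∈N (proj₂ (∈-filter⁻ (_∈? U) {xs = allFin n} u∈))))))

  ∈-commonNeighbours⁻ : w ∈ commonNeighbours G U → ∀ {u} → u ∈ U → w ∈ neighbourhood G u
  ∈-commonNeighbours⁻ w∈ {u} u∈U =
    All.lookup (All.map⁻ (∈-⋂⁻ _ (proj₂ (x∈p∩q⁻ (V G) _ w∈))))
               (∈-filter⁺ (_∈? U) (∈-allFin u) u∈U)

x∉p-x : (p : Subset n) (u : Fin n) → u ∉ p - u
-- For `zero` the difference has head `outside`, so there is no membership proof to consider.
x∉p-x (s Vec.∷ p) (suc u) u∈ = x∉p-x p u (drop-there u∈)

-- Faces with and without a given vertex

module Deletion (G : Graph n) (v : Fin n) (v∈V : v ∈ V G) where
  open Graph G using (_~_; ~-sym; ~-irrefl; ~⇒∈V)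

  G′ : Graph n
  G′ = delete G v

  V′⊆V : V G′ ⊆ V G
  V′⊆V = p─q⊆p (V G) _

  ∉A⇒A⊆V′ : ∀ {A} → A ⊆ V G → v ∉ A → A ⊆ V G′
  ∉A⇒A⊆V′ A⊆V v∉A u∈A = x∈p∧x≢y⇒x∈p-y (A⊆V u∈A) (λ { refl → v∉A u∈A })

  v∉N : v ∉ neighbourhood G v
  v∉N v∈N = ~-irrefl refl (∈-neighbourhood⁻ G v∈N)

  N⊆V′ : neighbourhood G v ⊆ V G′
  N⊆V′ = ∉A⇒A⊆V′ (neighbourhood⊆V G) v∉N

  N′⊆N : ∀ {w} → neighbourhood G′ w ⊆ neighbourhood G w
  N′⊆N u∈ = let _ , _ , w~u = ∈-neighbourhood⁻ G′ u∈ in ∈-neighbourhood⁺ G w~u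

  N⊆N′ : ∀ {u w} → w ∈ V G′ → u ∈ V G′ → u ∈ neighbourhood G w → u ∈ neighbourhood G′ w
  N⊆N′ w∈ u∈ u∈N = ∈-neighbourhood⁺ G′ (w∈ , u∈ , ∈-neighbourhood⁻ G u∈N)

  module _ (V′≠∅ : Nonempty (V G′)) where

    -- The cases follow the vertex `w` whose neighbourhood contains `A`. If `w` is not `v`, it
    -- survives the deletion. If `w` is `v`, then `A` lies in the neighbourhood of `v` and stays a
    -- face exactly when it is empty or has a common neighbour in `G′`.
    faces-without : ∀ A →
      ⟦ ¬? (v ∈? A) ×-dec (A ∈𝒩? G) ⟧
      ≡ ⟦ A ∈𝒩? G′ ⟧
        ℤ.+ ⟦ (A ⊆? neighbourhood G v ×-dec nonempty? A)
              ×-dec ¬? (nonempty? (commonNeighbours G′ A)) ⟧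
    faces-without A = ⟦⟧-⊎ (¬? (v ∈? A) ×-dec (A ∈𝒩? G)) (A ∈𝒩? G′)
        ((A ⊆? neighbourhood G v ×-dec nonempty? A)
          ×-dec ¬? (nonempty? (commonNeighbours G′ A)))
        to from-face from-N disjoint
      where
      Isolated : Set
      Isolated = (A ⊆ neighbourhood G v × Nonempty A) × ¬ Nonempty (commonNeighbours G′ A)

      to : v ∉ A × A ∈𝒩 G → A ∈𝒩 G′ ⊎ Isolated
      to (v∉A , A⊆V , w , w∈V , A⊆N) with w ≟ v
      ... | no w≢v   = inj₁ (A⊆V′ , w , w∈V′ , λ u∈A → N⊆N′ w∈V′ (A⊆V′ u∈A) (A⊆N u∈A))
        where
        w∈V′ = x∈p∧x≢y⇒x∈p-y w∈V w≢v
        A⊆V′ : A ⊆ V G′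
        A⊆V′ = ∉A⇒A⊆V′ A⊆V v∉A
      ... | yes refl with nonempty? A
      -- Any vertex of `G′` witnesses that the empty set is a face; `V′≠∅` supplies one.
      ...   | no A=∅ = let c , c∈V′ = V′≠∅ in
                       inj₁ (∉A⇒A⊆V′ A⊆V v∉A , c , c∈V′ , λ u∈A → contradiction (_ , u∈A) A=∅)
      ...   | yes A≠∅ with nonempty? (commonNeighbours G′ A)
      ...     | no C=∅       = inj₂ ((A⊆N , A≠∅) , C=∅)
      -- By symmetry of adjacency, a common neighbour of `A` is a vertex whose neighbourhood
      -- contains `A`.
      ...     | yes (c , c∈C) =
        inj₁ ( ∉A⇒A⊆V′ A⊆V v∉A , c , proj₁ (x∈p∩q⁻ (V G′) _ c∈C)
             , λ u∈A → neighbourhood-sym G′ (∈-commonNeighbours⁻ G′ c∈C u∈A))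

      from-face : A ∈𝒩 G′ → v ∉ A × A ∈𝒩 G
      from-face (A⊆V′ , w , w∈V′ , A⊆N′) =
        (λ v∈A → x∉p-x (V G) v (A⊆V′ v∈A)) ,
        (λ u∈A → V′⊆V (A⊆V′ u∈A)) , w , V′⊆V w∈V′ , λ u∈A → N′⊆N (A⊆N′ u∈A)

      from-N : Isolated → v ∉ A × A ∈𝒩 G
      from-N ((A⊆N , _) , _) =
        (λ v∈A → v∉N (A⊆N v∈A)) , (λ u∈A → neighbourhood⊆V G (A⊆N u∈A)) , v , v∈V , A⊆N

      disjoint : A ∈𝒩 G′ → ¬ Isolated
      disjoint (_ , w , w∈V′ , A⊆N′) (_ , C=∅) =
        C=∅ (w , ∈-commonNeighbours⁺ G′ w∈V′ (λ u∈A → neighbourhood-sym G′ (A⊆N′ u∈A)))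

  apex? : ∀ B → Decidable (λ w → w ∈ neighbourhood G v × B ⊆ neighbourhood G′ w)
  apex? B w = w ∈? neighbourhood G v ×-dec B ⊆? neighbourhood G′ w

  -- The set W_B, as a `Subset` so that `inclusion-exclusion` applies to it.
  apices : Subset n → Subset n
  apices B = tabulate (does ∘ apex? B)

  -- A vertex adjacent to all of `B` and to `v` is a neighbour of `v`, hence differs from `v` and
  -- survives the deletion. Conversely, `v ∉ B` is recovered from the fact that neighbourhoods in
  -- `G′` avoid `v`.
  faces-with : ∀ B → ⟦ ¬? (v ∈? B) ×-dec ((B [ v ]≔ inside) ∈𝒩? G) ⟧ ≡ ⟦ nonempty? (apices B) ⟧
  faces-with B = ⟦⟧-cong (¬? (v ∈? B) ×-dec ((B [ v ]≔ inside) ∈𝒩? G)) (nonempty? (apices B)) to from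
    where
    to : v ∉ B × (B [ v ]≔ inside) ∈𝒩 G → Nonempty (apices B)
    to (v∉B , B+v⊆V , w , w∈V , B+v⊆N) = w , ∈-tabulate⁺ (apex? B)
      (w∈N , λ u∈B → N⊆N′ (N⊆V′ w∈N) (∉A⇒A⊆V′ (B+v⊆V ∘ ⊆-insert v B) v∉B u∈B)
                          (B+v⊆N (⊆-insert v B u∈B)))
      where w∈N = neighbourhood-sym G (B+v⊆N ([]≔-updates B v))

    from : Nonempty (apices B) → v ∉ B × (B [ v ]≔ inside) ∈𝒩 G
    from (w , w∈) =
        (λ v∈B → x∉p-x (V G) v (neighbourhood⊆V G′ {w} (B⊆N′ v∈B)))
      , (λ u∈ → neighbourhood⊆V G (B+v⊆N u∈)) , w , V′⊆V (N⊆V′ w∈N) , B+v⊆N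
      where
      w∈N = proj₁ (∈-tabulate⁻ (apex? B) w∈)
      B⊆N′ : B ⊆ neighbourhood G′ w
      B⊆N′ = proj₂ (∈-tabulate⁻ (apex? B) w∈)
      B+v⊆N : B [ v ]≔ inside ⊆ neighbourhood G w
      B+v⊆N u∈ with ∈-insert⁻ v B u∈
      ... | inj₁ refl = neighbourhood-sym G w∈N
      ... | inj₂ u∈B  = N′⊆N (B⊆N′ u∈B)

  -- Both sides say that `U` is a nonempty set of neighbours of `v`, each adjacent in `G′` to every
  -- element of `B`. This prepares the exchange of the sums over `B` and `U`.
  ⊆-apices : ∀ B U →
    ⟦ U ⊆? apices B ×-dec nonempty? U ⟧
    ≡ ⟦ (U ⊆? neighbourhood G v ×-dec nonempty? U) ×-dec (B ⊆? commonNeighbours G′ U) ⟧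
  ⊆-apices B U = ⟦⟧-cong (U ⊆? apices B ×-dec nonempty? U)
      ((U ⊆? neighbourhood G v ×-dec nonempty? U) ×-dec (B ⊆? commonNeighbours G′ U))
    (λ (U⊆ , w , w∈U) →
      ((λ u∈U → proj₁ (∈-tabulate⁻ (apex? B) (U⊆ u∈U))) , w , w∈U) ,
      λ b∈B → ∈-commonNeighbours⁺ G′
        -- Nonemptiness of `U` enters here: adjacency to `w` puts the element of `B` into `V G′`.
        (neighbourhood⊆V G′ {w} (proj₂ (∈-tabulate⁻ (apex? B) (U⊆ w∈U)) b∈B))
        (λ u∈U → proj₂ (∈-tabulate⁻ (apex? B) (U⊆ u∈U)) b∈B))
    (λ ((U⊆N , U≠∅) , B⊆C) →
      (λ u∈U → ∈-tabulate⁺ (apex? B) (U⊆N u∈U , λ b∈B → ∈-commonNeighbours⁻ G′ (B⊆C b∈B) u∈U)) , U≠∅)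

  -- Coefficients contributed by the faces without and with `v`

  module _ (k : ℕ) where

    coeff-without : Nonempty (V G′) →
      sum (λ A → ⟦ ¬? (v ∈? A) ⟧ ℤ.* (⟦ A ∈𝒩? G ⟧ ℤ.* coeff (x ^ ∣ A ∣) k))
      ≡ coeff (N G′) k
        ℤ.+ coeff (∑ (λ U → U ⊆? neighbourhood G v ×-dec nonempty? U) (term G v)) k
    coeff-without V′≠∅ = begin
      sum (λ A → ⟦ ¬? (v ∈? A) ⟧ ℤ.* (⟦ A ∈𝒩? G ⟧ ℤ.* coeff (x ^ ∣ A ∣) k))
        ≡⟨ sum-cong pointwise ⟩
      sum (λ A → ⟦ A ∈𝒩? G′ ⟧ ℤ.* coeff (x ^ ∣ A ∣) k
                 ℤ.+ ⟦ A ⊆? neighbourhood G v ×-dec nonempty? A ⟧ ℤ.* coeff (term G v A) k)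
        ≡⟨ sum-+ (λ A → ⟦ A ∈𝒩? G′ ⟧ ℤ.* coeff (x ^ ∣ A ∣) k)
                 (λ A → ⟦ A ⊆? neighbourhood G v ×-dec nonempty? A ⟧ ℤ.* coeff (term G v A) k) ⟩
      sum (λ A → ⟦ A ∈𝒩? G′ ⟧ ℤ.* coeff (x ^ ∣ A ∣) k)
        ℤ.+ sum (λ A → ⟦ A ⊆? neighbourhood G v ×-dec nonempty? A ⟧ ℤ.* coeff (term G v A) k)
        ≡⟨ cong₂ ℤ._+_ (coeff-∑ (_∈𝒩? G′) (λ A → x ^ ∣ A ∣) k)
             (coeff-∑ (λ U → U ⊆? neighbourhood G v ×-dec nonempty? U) (term G v) k) ⟨
      coeff (N G′) k
        ℤ.+ coeff (∑ (λ U → U ⊆? neighbourhood G v ×-dec nonempty? U) (term G v)) k ∎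
      where
      -- Turns the case distinction of `term` into a bracket factor, the form in which
      -- `faces-without` delivers it.
      coeff-term : ∀ A → coeff (term G v A) k
                 ≡ ⟦ ¬? (nonempty? (commonNeighbours G′ A)) ⟧ ℤ.* coeff (x ^ ∣ A ∣) k
      coeff-term A with nonempty? (commonNeighbours G′ A)
      ... | yes _ = refl
      ... | no _  = sym (ℤ.*-identityˡ _)

      pointwise : ∀ A →
        ⟦ ¬? (v ∈? A) ⟧ ℤ.* (⟦ A ∈𝒩? G ⟧ ℤ.* coeff (x ^ ∣ A ∣) k)
        ≡ ⟦ A ∈𝒩? G′ ⟧ ℤ.* coeff (x ^ ∣ A ∣) k
          ℤ.+ ⟦ A ⊆? neighbourhood G v ×-dec nonempty? A ⟧ ℤ.* coeff (term G v A) k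
      pointwise A = begin
        ⟦ v∉A? ⟧ ℤ.* (⟦ A ∈𝒩? G ⟧ ℤ.* e)   ≡⟨ ℤ.*-assoc ⟦ v∉A? ⟧ ⟦ A ∈𝒩? G ⟧ e ⟨
        ⟦ v∉A? ⟧ ℤ.* ⟦ A ∈𝒩? G ⟧ ℤ.* e     ≡⟨ cong (ℤ._* e) (⟦⟧-× v∉A? (A ∈𝒩? G)) ⟨
        ⟦ v∉A? ×-dec (A ∈𝒩? G) ⟧ ℤ.* e     ≡⟨ cong (ℤ._* e) (faces-without V′≠∅ A) ⟩
        (⟦ A ∈𝒩? G′ ⟧ ℤ.+ ⟦ N? ×-dec C? ⟧) ℤ.* e
          ≡⟨ ℤ.*-distribʳ-+ e ⟦ A ∈𝒩? G′ ⟧ ⟦ N? ×-dec C? ⟧ ⟩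
        ⟦ A ∈𝒩? G′ ⟧ ℤ.* e ℤ.+ ⟦ N? ×-dec C? ⟧ ℤ.* e
          ≡⟨ cong (λ i → ⟦ A ∈𝒩? G′ ⟧ ℤ.* e ℤ.+ i) (begin
               ⟦ N? ×-dec C? ⟧ ℤ.* e         ≡⟨ cong (ℤ._* e) (⟦⟧-× N? C?) ⟩
               ⟦ N? ⟧ ℤ.* ⟦ C? ⟧ ℤ.* e       ≡⟨ ℤ.*-assoc ⟦ N? ⟧ ⟦ C? ⟧ e ⟩
               ⟦ N? ⟧ ℤ.* (⟦ C? ⟧ ℤ.* e)     ≡⟨ cong (λ i → ⟦ N? ⟧ ℤ.* i) (coeff-term A) ⟨
               ⟦ N? ⟧ ℤ.* coeff (term G v A) k ∎) ⟩
        ⟦ A ∈𝒩? G′ ⟧ ℤ.* e ℤ.+ ⟦ N? ⟧ ℤ.* coeff (term G v A) k ∎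
        where
        e    = coeff (x ^ ∣ A ∣) k
        v∉A? = ¬? (v ∈? A)
        N?   = A ⊆? neighbourhood G v ×-dec nonempty? A
        C?   = ¬? (nonempty? (commonNeighbours G′ A))

    -- The bracket of `faces-with` is written as a signed sum over `U`. After the exchange, the
    -- inner sum over `B` is a binomial expansion over the common neighbours of `U`.
    coeff-with :
      sum (λ B → ⟦ ¬? (v ∈? B) ⟧
                 ℤ.* (⟦ (B [ v ]≔ inside) ∈𝒩? G ⟧ ℤ.* coeff (x ^ ∣ B [ v ]≔ inside ∣) k))
      ≡ coeff (∑ (λ U → U ⊆? neighbourhood G v ×-dec nonempty? U)
                 (λ U → const (sign U) * x * (𝟙 + x) ^ ∣ commonNeighbours G′ U ∣)) k
    coeff-with = begin
      sum (λ B → ⟦ ¬? (v ∈? B) ⟧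
                 ℤ.* (⟦ (B [ v ]≔ inside) ∈𝒩? G ⟧ ℤ.* coeff (x ^ ∣ B [ v ]≔ inside ∣) k))
        ≡⟨ sum-cong expand ⟩
      sum (λ B → sum (λ U → ⟦ N? U ⟧ ℤ.* (sign U ℤ.* (⟦ B ⊆? C U ⟧ ℤ.* e B))))
        ≡⟨ sum-swap (λ B U → ⟦ N? U ⟧ ℤ.* (sign U ℤ.* (⟦ B ⊆? C U ⟧ ℤ.* e B))) ⟩
      sum (λ U → sum (λ B → ⟦ N? U ⟧ ℤ.* (sign U ℤ.* (⟦ B ⊆? C U ⟧ ℤ.* e B))))
        ≡⟨ sum-cong collect ⟩
      sum (λ U → ⟦ N? U ⟧ ℤ.* coeff (const (sign U) * x * (𝟙 + x) ^ ∣ C U ∣) k)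
        ≡⟨ coeff-∑ N? (λ U → const (sign U) * x * (𝟙 + x) ^ ∣ C U ∣) k ⟨
      coeff (∑ N? (λ U → const (sign U) * x * (𝟙 + x) ^ ∣ C U ∣)) k ∎
      where
      N? : Decidable (λ U → U ⊆ neighbourhood G v × Nonempty U)
      N? U = U ⊆? neighbourhood G v ×-dec nonempty? U

      C : Subset n → Subset n
      C = commonNeighbours G′

      e : Subset n → ℤ
      e B = coeff (x ^ suc ∣ B ∣) k

      size : ∀ B → ⟦ ¬? (v ∈? B) ⟧
                     ℤ.* (⟦ (B [ v ]≔ inside) ∈𝒩? G ⟧ ℤ.* coeff (x ^ ∣ B [ v ]≔ inside ∣) k)
                 ≡ ⟦ ¬? (v ∈? B) ⟧ ℤ.* (⟦ (B [ v ]≔ inside) ∈𝒩? G ⟧ ℤ.* e B)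
      -- If `v` is in `B`, insertion does not raise the size, but the weight is 0 and both sides
      -- vanish.
      size B with v ∈? B
      ... | yes _  = refl
      ... | no v∉B = cong (λ m → 1ℤ ℤ.* (⟦ (B [ v ]≔ inside) ∈𝒩? G ⟧ ℤ.* coeff (x ^ m) k))
                          (∣insert∣ v B v∉B)

      expand : ∀ B →
        ⟦ ¬? (v ∈? B) ⟧
          ℤ.* (⟦ (B [ v ]≔ inside) ∈𝒩? G ⟧ ℤ.* coeff (x ^ ∣ B [ v ]≔ inside ∣) k)
        ≡ sum (λ U → ⟦ N? U ⟧ ℤ.* (sign U ℤ.* (⟦ B ⊆? C U ⟧ ℤ.* e B)))
      expand B = begin
        ⟦ v∉B? ⟧ ℤ.* (⟦ B+v? ⟧ ℤ.* coeff (x ^ ∣ B [ v ]≔ inside ∣) k) ≡⟨ size B ⟩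
        ⟦ v∉B? ⟧ ℤ.* (⟦ B+v? ⟧ ℤ.* e B)   ≡⟨ ℤ.*-assoc ⟦ v∉B? ⟧ ⟦ B+v? ⟧ (e B) ⟨
        ⟦ v∉B? ⟧ ℤ.* ⟦ B+v? ⟧ ℤ.* e B     ≡⟨ cong (ℤ._* e B) (⟦⟧-× v∉B? B+v?) ⟨
        ⟦ v∉B? ×-dec B+v? ⟧ ℤ.* e B       ≡⟨ cong (ℤ._* e B) (faces-with B) ⟩
        ⟦ nonempty? (apices B) ⟧ ℤ.* e B  ≡⟨ cong (ℤ._* e B) (inclusion-exclusion (apices B)) ⟨
        sum (λ U → ⟦ W? U ⟧ ℤ.* sign U) ℤ.* e B
          ≡⟨ ℤ.*-comm (sum (λ U → ⟦ W? U ⟧ ℤ.* sign U)) (e B) ⟩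
        e B ℤ.* sum (λ U → ⟦ W? U ⟧ ℤ.* sign U)
          ≡⟨ sum-* (e B) (λ U → ⟦ W? U ⟧ ℤ.* sign U) ⟨
        sum (λ U → e B ℤ.* (⟦ W? U ⟧ ℤ.* sign U))
          ≡⟨ sum-cong (λ U → trans
               (cong (λ i → e B ℤ.* (i ℤ.* sign U))
                     (trans (⊆-apices B U) (⟦⟧-× (N? U) (B ⊆? C U))))
               (rearrange ⟦ N? U ⟧ (sign U) ⟦ B ⊆? C U ⟧ (e B))) ⟩
        sum (λ U → ⟦ N? U ⟧ ℤ.* (sign U ℤ.* (⟦ B ⊆? C U ⟧ ℤ.* e B))) ∎
        where
        v∉B? = ¬? (v ∈? B)
        B+v? = (B [ v ]≔ inside) ∈𝒩? G

        W? : Decidable (λ U → U ⊆ apices B × Nonempty U)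
        W? U = U ⊆? apices B ×-dec nonempty? U

        rearrange : ∀ a s b c → c ℤ.* ((a ℤ.* b) ℤ.* s) ≡ a ℤ.* (s ℤ.* (b ℤ.* c))
        rearrange = solve-∀

      collect : ∀ U →
        sum (λ B → ⟦ N? U ⟧ ℤ.* (sign U ℤ.* (⟦ B ⊆? C U ⟧ ℤ.* e B)))
        ≡ ⟦ N? U ⟧ ℤ.* coeff (const (sign U) * x * (𝟙 + x) ^ ∣ C U ∣) k
      collect U = begin
        sum (λ B → ⟦ N? U ⟧ ℤ.* (sign U ℤ.* (⟦ B ⊆? C U ⟧ ℤ.* e B)))
          ≡⟨ sum-* ⟦ N? U ⟧ (λ B → sign U ℤ.* (⟦ B ⊆? C U ⟧ ℤ.* e B)) ⟩
        ⟦ N? U ⟧ ℤ.* sum (λ B → sign U ℤ.* (⟦ B ⊆? C U ⟧ ℤ.* e B))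
          ≡⟨ cong (λ i → ⟦ N? U ⟧ ℤ.* i) (begin
               sum (λ B → sign U ℤ.* (⟦ B ⊆? C U ⟧ ℤ.* e B))
                 ≡⟨ sum-* (sign U) (λ B → ⟦ B ⊆? C U ⟧ ℤ.* e B) ⟩
               sign U ℤ.* sum (λ B → ⟦ B ⊆? C U ⟧ ℤ.* e B)
                 ≡⟨ cong (λ i → sign U ℤ.* i) (shift-coeff-[1+x]^ (C U) k) ⟨
               sign U ℤ.* shift (coeff ((𝟙 + x) ^ ∣ C U ∣)) k
                 ≡⟨ coeff-const-*-x-* (sign U) ((𝟙 + x) ^ ∣ C U ∣) k ⟨
               coeff (const (sign U) * x * (𝟙 + x) ^ ∣ C U ∣) k ∎) ⟩
        ⟦ N? U ⟧ ℤ.* coeff (const (sign U) * x * (𝟙 + x) ^ ∣ C U ∣) k ∎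

corollary10 : (n : ℕ) (G : Graph n) (v : Fin n) → v ∈ V G → Nonempty (V (delete G v)) →
    N G ≈ N (delete G v)
    + ∑ (λ U → U ⊆? neighbourhood G v ×-dec nonempty? U)
    (λ U → const (-1ℤ ℤ.^ (∣ U ∣ ℕ.+ 1)) * x * (𝟙 + x) ^ ∣ commonNeighbours (delete G v) U ∣)
    + ∑ (λ U → U ⊆? neighbourhood G v ×-dec nonempty? U) (λ U → term G v U)
corollary10 n G v v∈V V′≠∅ k = begin
  coeff (N G) k
    ≡⟨ coeff-∑ (_∈𝒩? G) (λ A → x ^ ∣ A ∣) k ⟩
  sum f
    ≡⟨ sum-split v f ⟩
  sum (λ A → ⟦ ¬? (v ∈? A) ⟧ ℤ.* f A) ℤ.+ sum (λ A → ⟦ ¬? (v ∈? A) ⟧ ℤ.* f (A [ v ]≔ inside))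
    ≡⟨ cong₂ ℤ._+_ (coeff-without k V′≠∅) (coeff-with k) ⟩
  (coeff (N G′) k ℤ.+ coeff T k) ℤ.+ coeff S k
    -- The faces avoiding `v` gave the first two summands and those containing `v` gave `S`, which
    -- the formula puts before `T`.
    ≡⟨ swap (coeff (N G′) k) (coeff T k) (coeff S k) ⟩
  (coeff (N G′) k ℤ.+ coeff S k) ℤ.+ coeff T k
    ≡⟨ cong (ℤ._+ coeff T k) (coeff-+ (N G′) S k) ⟨
  coeff (N G′ + S) k ℤ.+ coeff T k
    ≡⟨ coeff-+ (N G′ + S) T k ⟨
  coeff (N G′ + S + T) k ∎
  where
  open Deletion G v v∈V

  f : Subset n → ℤ
  f A = ⟦ A ∈𝒩? G ⟧ ℤ.* coeff (x ^ ∣ A ∣) k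

  S T : Poly
  S = ∑ (λ U → U ⊆? neighbourhood G v ×-dec nonempty? U)
        (λ U → const (sign U) * x * (𝟙 + x) ^ ∣ commonNeighbours G′ U ∣)
  T = ∑ (λ U → U ⊆? neighbourhood G v ×-dec nonempty? U) (term G v)

  swap : ∀ a b c → (a ℤ.+ b) ℤ.+ c ≡ (a ℤ.+ c) ℤ.+ b
  swap = solve-∀
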